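{- There is an absolute constant $c>0$ such that for all integers $n\geq 1$ $$r_4(\mathbb{Z}_{11}^n) \geq c\, \frac{7^n}{n^3}. $$
   Context: $\mathbb{Z}_m^n$ denotes the additive group $(\mathbb{Z}/m\mathbb{Z})^n$. A proper arithmetic progression of length $k$ in $\mathbb{Z}_m^n$ is a sequence $x, x+d, \ldots, x+(k-1)d$ (with $x,d\in\mathbb{Z}_m^n$) whose $k$ elements are pairwise distinct. $r_k(\mathbb{Z}_m^n)$ denotes the maximal size of a set $S\subseteq\mathbb{Z}_m^n$ that does not contain a proper arithmetic progression of length $k$. -}

module Defs where

open import Data.Empty using (⊥-elim)
open import Data.Fin.Base as Fin using (Fin; toℕ)
import Data.Fin.Properties as Fin
open import Data.List.Base as List using (List; []; _∷_; length; allFin; cartesianProductWith)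
open import Data.List.Membership.Propositional using (_∈_; find; lose)
open import Data.List.Membership.Propositional.Properties
  using (∈-allFin; ∈-cartesianProductWith⁺; ∈-lookup)
open import Data.List.Relation.Unary.All as All using ()
open import Data.List.Relation.Unary.Any as Any using (here; any?; index)
open import Data.List.Relation.Unary.Any.Properties using (lookup-index)
open import Data.List.Relation.Unary.Unique.Propositional using (Unique; []; _∷_)
open import Data.Nat.Base using (ℕ; zero; suc; _+_; _≤_; NonZero)
open import Data.Nat.DivMod using (_mod_)
open import Data.Nat.Properties using (m≤n⇒m<n∨m≡n; ≤-pred)
open import Data.Product.Base using (∃; _×_; _,_; proj₁; proj₂)
open import Data.Sum.Base using (inj₁; inj₂)
open import Data.Vec.Base as Vec using (Vec; []; _∷_; zipWith; toList; fromList)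
open import Data.Vec.Properties using (≡-dec; length-toList; toList∘fromList)
open import Function.Definitions using (Injective)
open import Relation.Binary.PropositionalEquality
  using (_≡_; refl; sym; cong; subst; module ≡-Reasoning)
open import Relation.Nullary.Decidable using (Dec; yes; no; map′; ¬?; _×-dec_; _→-dec_)
open import Relation.Nullary.Negation using (¬_)
open import Relation.Unary using (Decidable)

-- The underlying set of (ℤ/mℤ)ⁿ, a residue class being given by its
-- representative in {0, …, m - 1}.
ℤMod^ : ℕ → ℕ → Set
ℤMod^ m n = Vec (Fin m) n

module _ {m n : ℕ} .{{_ : NonZero m}} where

  infixl 6 _⊕_

  _⊕_ : ℤMod^ m n → ℤMod^ m n → ℤMod^ m n
  _⊕_ = zipWith (λ a b → (toℕ a + toℕ b) mod m)

  -- term x d i is x + i d.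
  term : ℤMod^ m n → ℤMod^ m n → ℕ → ℤMod^ m n
  term x d zero    = x
  term x d (suc i) = term x d i ⊕ d

  Proper : ℕ → ℤMod^ m n → ℤMod^ m n → Set
  Proper k x d = Injective _≡_ _≡_ (λ (i : Fin k) → term x d (toℕ i))

  -- Finite sets are lists without repetitions; see IsSizeOfFreeSet.
  ProgressionFree : ℕ → List (ℤMod^ m n) → Set
  ProgressionFree k S =
    ∀ x d → Proper k x d → ¬ (∀ (i : Fin k) → term x d (toℕ i) ∈ S)

IsSizeOfFreeSet : (k m n : ℕ) .{{_ : NonZero m}} → ℕ → Set
IsSizeOfFreeSet k m n s =
  ∃ λ (S : List (ℤMod^ m n)) → Unique S × ProgressionFree k S × length S ≡ s

IsMaximum : (ℕ → Set) → ℕ → Set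
IsMaximum P s = P s × (∀ t → P t → t ≤ s)

-- The remaining lemmas show that a maximal size exists.

boundedMaximum : ∀ {P : ℕ → Set} → Decidable P → P 0 →
                 ∀ b → (∀ t → P t → t ≤ b) → ∃ (IsMaximum P)
boundedMaximum P? P0 zero    bound = 0 , P0 , bound
boundedMaximum P? P0 (suc b) bound with P? (suc b)
... | yes Pb = suc b , Pb , bound
... | no ¬Pb = boundedMaximum P? P0 b bound′
  where
  bound′ : ∀ t → _ → t ≤ b
  bound′ t Pt with m≤n⇒m<n∨m≡n (bound t Pt)
  ... | inj₁ t<1+b = ≤-pred t<1+b
  ... | inj₂ refl  = ⊥-elim (¬Pb Pt)

vectors : ∀ {A : Set} → List A → ∀ n → List (Vec A n)
vectors xs zero    = [] ∷ []
vectors xs (suc n) = cartesianProductWith _∷_ xs (vectors xs n)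

∈-vectors : ∀ {A : Set} {xs : List A} → (∀ a → a ∈ xs) →
            ∀ {n} (v : Vec A n) → v ∈ vectors xs n
∈-vectors a∈xs []      = here refl
∈-vectors a∈xs (a ∷ v) = ∈-cartesianProductWith⁺ _∷_ (a∈xs a) (∈-vectors a∈xs v)

lookup-injective : ∀ {A : Set} {ys : List A} → Unique ys →
                   Injective _≡_ _≡_ (List.lookup ys)
lookup-injective (y∉ys ∷ ys!) {Fin.zero}  {Fin.zero}  eq = refl
lookup-injective (y∉ys ∷ ys!) {Fin.zero}  {Fin.suc j} eq =
  ⊥-elim (All.lookup y∉ys (∈-lookup j) eq)
lookup-injective (y∉ys ∷ ys!) {Fin.suc i} {Fin.zero}  eq =
  ⊥-elim (All.lookup y∉ys (∈-lookup i) (sym eq))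
lookup-injective (y∉ys ∷ ys!) {Fin.suc i} {Fin.suc j} eq =
  cong Fin.suc (lookup-injective ys! eq)

module Exhaustive {A : Set} {xs : List A} (a∈xs : ∀ a → a ∈ xs) where

  ∀? : ∀ {P : A → Set} → Decidable P → Dec (∀ a → P a)
  ∀? P? = map′ (λ all a → All.lookup all (a∈xs a)) (λ f → All.tabulate (λ {a} _ → f a))
               (All.all? P? xs)

  ∃? : ∀ {P : A → Set} → Decidable P → Dec (∃ P)
  ∃? P? = map′ (λ any → let a , _ , Pa = find any in a , Pa) (λ (a , Pa) → lose (a∈xs a) Pa)
               (any? P? xs)

  unique⇒length≤ : ∀ {ys : List A} → Unique ys → length ys ≤ length xs
  unique⇒length≤ {ys} ys! = Fin.injective⇒≤ {f = f} f-injective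
    where
    f : Fin (length ys) → Fin (length xs)
    f i = index (a∈xs (List.lookup ys i))

    f-injective : Injective _≡_ _≡_ f
    f-injective {i} {j} fi≡fj = lookup-injective ys! (begin
      List.lookup ys i      ≡⟨ lookup-index (a∈xs (List.lookup ys i)) ⟩
      List.lookup xs (f i)  ≡⟨ cong (List.lookup xs) fi≡fj ⟩
      List.lookup xs (f j)  ≡⟨ lookup-index (a∈xs (List.lookup ys j)) ⟨
      List.lookup ys j      ∎)
      where open ≡-Reasoning

module _ {m n : ℕ} .{{_ : NonZero m}} where

  private
    _≟_ : (x y : ℤMod^ m n) → Dec (x ≡ y)
    _≟_ = ≡-dec Fin._≟_

  open import Data.List.Membership.DecPropositional _≟_ using (_∈?_)
  open import Data.List.Relation.Unary.Unique.DecPropositional _≟_ using (unique?)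

  points : List (ℤMod^ m n)
  points = vectors (allFin m) n

  ∈-points : ∀ x → x ∈ points
  ∈-points = ∈-vectors ∈-allFin

  open Exhaustive ∈-points

  proper? : ∀ k x d → Dec (Proper {m} {n} k x d)
  proper? k x d = map′ (λ f {i} {j} → f i j) (λ f i j → f {i} {j})
    (Fin.all? λ i → Fin.all? λ j →
      (term x d (toℕ i) ≟ term x d (toℕ j)) →-dec (i Fin.≟ j))

  progressionFree? : ∀ k S → Dec (ProgressionFree {m} {n} k S)
  progressionFree? k S = ∀? λ x → ∀? λ d →
    proper? k x d →-dec ¬? (Fin.all? λ i → term x d (toℕ i) ∈? S)

  isSizeOfFreeSet? : ∀ k → Decidable (IsSizeOfFreeSet k m n)
  isSizeOfFreeSet? k s = map′
    (λ (v , v! , free) → toList v , v! , free , length-toList v)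
    (λ { (S , S! , free , refl) → fromList S
       , subst Unique (sym (toList∘fromList S)) S!
       , subst (ProgressionFree k) (sym (toList∘fromList S)) free })
    (Exhaustive.∃? (∈-vectors ∈-points) λ (v : Vec _ s) →
      unique? (toList v) ×-dec progressionFree? k (toList v))

-- For k = 0 there is no maximum, as every set contains the empty progression.
maximumExists : ∀ k m n .{{_ : NonZero k}} .{{_ : NonZero m}} →
                ∃ (IsMaximum (IsSizeOfFreeSet k m n))
maximumExists (suc k) m n = boundedMaximum (isSizeOfFreeSet? (suc k))
  ([] , [] , (λ x d _ ∈[] → case∈[] (∈[] Fin.zero)) , refl)
  (length (points {m} {n}))
  λ { _ (S , S! , _ , refl) → Exhaustive.unique⇒length≤ ∈-points S! }
  where
  case∈[] : ∀ {A B : Set} {a : A} → a ∈ [] → B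
  case∈[] ()

r : ∀ k m n .{{_ : NonZero k}} .{{_ : NonZero m}} → ℕ
r k m n = proj₁ (maximumExists k m n)

r-isMaximum : ∀ k m n .{{_ : NonZero k}} .{{_ : NonZero m}} →
              IsMaximum (IsSizeOfFreeSet k m n) (r k m n)
r-isMaximum k m n = proj₂ (maximumExists k m n)

{-# OPTIONS --safe #-}

-- Let D = {0, 1, 2, 3, 4, 6, 7} ⊆ ℤ/11. There is a function φ on D such that
-- φ(a) + φ(a + 3d) > φ(a + d) + φ(a + 2d) for each of the progressions of
-- length 4 in D with d ≠ 0. If w(x) = Σᵢ φ(xᵢ), then summing over coordinates
-- shows that w is not constant on a nontrivial progression in Dⁿ, so the
-- level sets of w on Dⁿ are progression free. As 0 ≤ w ≤ 2n, one of them has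
-- at least 7ⁿ / (2n + 1) elements, which is more than required.

module Submission where

open import Defs
open import Algebra.Properties.CommutativeSemigroup using (interchange)
open import Data.Fin.Base as Fin using (Fin; toℕ)
open import Data.Fin.Patterns using (0F; 1F; 2F; 3F; 4F; 6F; 7F)
import Data.Fin.Properties as Fin
open import Data.Integer.Base as ℤ using (+_; +≤+)
import Data.Integer.Properties as ℤ
open import Data.List.Base as List
  using (List; []; _∷_; length; filter; cartesianProductWith)
open import Data.List.Membership.DecPropositional (Fin._≟_ {11}) using (_∈?_)
open import Data.List.Membership.Propositional using (_∈_)
open import Data.List.Membership.Propositional.Properties
  using (∈-cartesianProductWith⁻; ∈-filter⁻)
open import Data.List.Properties using (length-++; length-map)
open import Data.List.Relation.Binary.Sublist.Propositional.Properties
  using (length-mono-≤; filter-⊆) renaming (filter⁺ to ⊆-filter⁺)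
open import Data.List.Relation.Unary.All as ListAll using ([]; _∷_)
open import Data.List.Relation.Unary.All.Properties using (all-filter)
  renaming (filter⁺ to All-filter⁺)
open import Data.List.Relation.Unary.Unique.DecPropositional (Fin._≟_ {11}) using (unique?)
open import Data.List.Relation.Unary.Unique.Propositional using (Unique; []; _∷_)
open import Data.List.Relation.Unary.Unique.Propositional.Properties
  using (cartesianProductWith⁺) renaming (filter⁺ to Unique-filter⁺)
open import Data.Nat.Base as ℕ using (ℕ; zero; suc; NonZero; _^_; _≤_; _<_; s≤s; z≤n)
open import Data.Nat.DivMod using (_mod_)
open import Data.Nat.Properties as ℕ using (m^n≢0)
open import Data.Product.Base using (∃; _×_; _,_; proj₁; proj₂)
open import Data.Rational.Base using (ℚ; 0ℚ; _/_; _*_; _>_; _≥_; toℚᵘ)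
import Data.Rational.Properties as ℚ
import Data.Rational.Unnormalised.Base as ℚᵘ
import Data.Rational.Unnormalised.Properties as ℚᵘ
open import Data.Sum.Base using (_⊎_; inj₁; inj₂)
open import Data.Vec.Base as Vec using (Vec; []; _∷_)
open import Data.Vec.Properties using (∷-injective)
open import Data.Vec.Relation.Unary.All as VecAll using ([]; _∷_)
open import Function.Base using (_∘_)
open import Relation.Binary.PropositionalEquality
  using (_≡_; refl; sym; trans; cong; cong₂; subst₂)
open import Relation.Nullary.Decidable
  using (yes; no; from-yes; _×-dec_; _⊎-dec_; _→-dec_)
open import Relation.Nullary.Negation using (contradiction)
open import Relation.Unary using (Decidable)
open import Relation.Unary.Properties using (∁?)

module _ {A : Set} where

  length-filter-∁ : ∀ {P : A → Set} (P? : Decidable P) xs →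
    length xs ≡ length (filter P? xs) ℕ.+ length (filter (∁? P?) xs)
  length-filter-∁ P? []       = refl
  length-filter-∁ P? (x ∷ xs) with P? x
  ... | yes _ = cong suc (length-filter-∁ P? xs)
  ... | no  _ = trans (cong suc (length-filter-∁ P? xs)) (sym (ℕ.+-suc _ _))

  fibre : (A → ℕ) → ℕ → List A → List A
  fibre f t = filter (λ x → f x ℕ.≟ t)

  -- Pigeonhole principle, by induction on `m`: split off the fibre over the largest value `m`. What
  -- remains takes values below `m`, and its fibres are sublists of the original ones, so the bound
  -- `b` persists.
  length≤*fibre : ∀ (f : A → ℕ) {b} m xs → (∀ t → length (fibre f t xs) ≤ b) →
    ListAll.All (λ x → f x < m) xs → length xs ≤ m ℕ.* b
  length≤*fibre f zero    []       small []         = z≤n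
  length≤*fibre f zero    (x ∷ xs) small (() ∷ _)
  length≤*fibre f {b} (suc m) xs small f<1+m = begin
    length xs                              ≡⟨ length-filter-∁ f≟m xs ⟩
    length (fibre f m xs) ℕ.+ length rest  ≤⟨ ℕ.+-mono-≤ (small m)
                                                (length≤*fibre f m rest rest-small rest<m) ⟩
    b ℕ.+ m ℕ.* b                          ∎
    where
    open ℕ.≤-Reasoning
    f≟m = λ x → f x ℕ.≟ m
    rest = filter (∁? f≟m) xs

    rest-small : ∀ t → length (fibre f t rest) ≤ b
    rest-small t = ℕ.≤-trans
      (length-mono-≤ (⊆-filter⁺ f≟t f≟t (λ { refl eq → eq }) (filter-⊆ (∁? f≟m) xs)))
      (small t)
      where f≟t = λ x → f x ℕ.≟ t

    rest<m : ListAll.All (λ x → f x < m) rest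
    rest<m = ListAll.zipWith (λ (f<1+m , f≢m) → ℕ.≤∧≢⇒< (ℕ.≤-pred f<1+m) f≢m)
      (All-filter⁺ (∁? f≟m) f<1+m , all-filter (∁? f≟m) xs)

length-cartesianProductWith : ∀ {A B C : Set} (f : A → B → C) xs ys →
  length (cartesianProductWith f xs ys) ≡ length xs ℕ.* length ys
length-cartesianProductWith f []       ys = refl
length-cartesianProductWith f (x ∷ xs) ys = trans (length-++ (List.map (f x) ys))
  (cong₂ ℕ._+_ (length-map (f x) ys) (length-cartesianProductWith f xs ys))

module _ {A : Set} (xs : List A) where

  length-vectors : ∀ n → length (vectors xs n) ≡ length xs ^ n
  length-vectors zero    = refl
  length-vectors (suc n) = trans (length-cartesianProductWith _∷_ xs (vectors xs n))
    (cong (length xs ℕ.*_) (length-vectors n))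

  vectors-unique : Unique xs → ∀ n → Unique (vectors xs n)
  vectors-unique xs! zero    = [] ∷ []
  vectors-unique xs! (suc n) =
    cartesianProductWith⁺ _∷_ ∷-injective xs! (vectors-unique xs! n)

  ∈-vectors⁻ : ∀ {n} (v : Vec A n) → v ∈ vectors xs n → VecAll.All (_∈ xs) v
  ∈-vectors⁻ []      _   = []
  ∈-vectors⁻ {suc n} (a ∷ v) a∷v∈
    with _ , _ , a∈ , v∈ , refl ← ∈-cartesianProductWith⁻ _∷_ xs (vectors xs n) a∷v∈
    = a∈ ∷ ∈-vectors⁻ v v∈

digits : List (Fin 11)
digits = 0F ∷ 1F ∷ 2F ∷ 3F ∷ 4F ∷ 6F ∷ 7F ∷ []

-- The values outside of digits are irrelevant.
φ : Fin 11 → ℕ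
φ = Vec.lookup (2 ∷ 0 ∷ 0 ∷ 1 ∷ 2 ∷ 0 ∷ 1 ∷ 0 ∷ 0 ∷ 0 ∷ 0 ∷ [])

weight : ∀ {n} → ℤMod^ 11 n → ℕ
weight = Vec.sum ∘ Vec.map φ

φ≤2 : ∀ a → φ a ≤ 2
φ≤2 = from-yes (Fin.all? λ a → φ a ℕ.≤? 2)

weight≤n*2 : ∀ {n} (x : ℤMod^ 11 n) → weight x ≤ n ℕ.* 2
weight≤n*2 []      = z≤n
weight≤n*2 (a ∷ x) = ℕ.+-mono-≤ (φ≤2 a) (weight≤n*2 x)

infixl 6 _+₁₁_

_+₁₁_ : Fin 11 → Fin 11 → Fin 11
a +₁₁ d = (toℕ a ℕ.+ toℕ d) mod 11

-- Checked over all 121 pairs of `a` and `d`. The case `b ≡ a` is the one with zero difference,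
-- where all four terms coincide; it records the equality so that such coordinates can be added to
-- strict ones.
φ-convex : ∀ a d → let b = a +₁₁ d ; c = b +₁₁ d ; e = c +₁₁ d in
  a ∈ digits → b ∈ digits → c ∈ digits → e ∈ digits →
  (b ≡ a × φ b ℕ.+ φ c ≡ φ a ℕ.+ φ e) ⊎ φ b ℕ.+ φ c < φ a ℕ.+ φ e
φ-convex = from-yes (Fin.all? λ a → Fin.all? λ d →
  let b = a +₁₁ d ; c = b +₁₁ d ; e = c +₁₁ d in
  (a ∈? digits) →-dec (b ∈? digits) →-dec (c ∈? digits) →-dec (e ∈? digits) →-dec
  (((b Fin.≟ a) ×-dec (φ b ℕ.+ φ c ℕ.≟ φ a ℕ.+ φ e))
    ⊎-dec (φ b ℕ.+ φ c ℕ.<? φ a ℕ.+ φ e)))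

-- Summing `φ-convex` over the coordinates: a single strict coordinate makes the sum strict, as all
-- the others contribute at least an equality. With no strict coordinate, the progression is
-- constant.
weight-convex : ∀ {n} (x d : ℤMod^ 11 n) →
  let y = x ⊕ d ; z = y ⊕ d ; u = z ⊕ d
      D = VecAll.All (_∈ digits) in
  D x → D y → D z → D u →
  (y ≡ x × weight y ℕ.+ weight z ≡ weight x ℕ.+ weight u) ⊎
  weight y ℕ.+ weight z < weight x ℕ.+ weight u
weight-convex []      []      _ _ _ _ = inj₁ (refl , refl)
weight-convex (a ∷ x) (δ ∷ d) (a∈ ∷ x∈) (b∈ ∷ y∈) (c∈ ∷ z∈) (e∈ ∷ u∈) =
  combine (φ-convex a δ a∈ b∈ c∈ e∈) (weight-convex x d x∈ y∈ z∈ u∈)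
  where
  y = x ⊕ d ; z = y ⊕ d ; u = z ⊕ d
  b = a +₁₁ δ ; c = b +₁₁ δ ; e = c +₁₁ δ

  -- Separates the head coordinate from the tails; the relation is arbitrary in order to serve both
  -- `_≡_` and `_<_`.
  regroup : ∀ (_∼_ : ℕ → ℕ → Set) →
    ((φ b ℕ.+ φ c) ℕ.+ (weight y ℕ.+ weight z)) ∼ ((φ a ℕ.+ φ e) ℕ.+ (weight x ℕ.+ weight u)) →
    (weight (b ∷ y) ℕ.+ weight (c ∷ z)) ∼ (weight (a ∷ x) ℕ.+ weight (e ∷ u))
  regroup _∼_ = subst₂ _∼_
    (interchange ℕ.+-commutativeSemigroup (φ b) (φ c) (weight y) (weight z))
    (interchange ℕ.+-commutativeSemigroup (φ a) (φ e) (weight x) (weight u))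

  combine : _ → _ → _
  combine (inj₁ (b≡a , φ≡)) (inj₁ (y≡x , w≡)) =
    inj₁ (cong₂ _∷_ b≡a y≡x , regroup _≡_ (cong₂ ℕ._+_ φ≡ w≡))
  combine (inj₁ (_ , φ≡)) (inj₂ w<) = inj₂ (regroup _<_ (ℕ.+-mono-≤-< (ℕ.≤-reflexive φ≡) w<))
  combine (inj₂ φ<) (inj₁ (_ , w≡)) = inj₂ (regroup _<_ (ℕ.+-mono-<-≤ φ< (ℕ.≤-reflexive w≡)))
  combine (inj₂ φ<) (inj₂ w<)       = inj₂ (regroup _<_ (ℕ.+-mono-< φ< w<))

level-progressionFree : ∀ n t → ProgressionFree 4 (fibre weight t (vectors digits n))
level-progressionFree n t x d proper terms∈ =
  conclude (weight-convex x d (digits∈ 0F) (digits∈ 1F) (digits∈ 2F) (digits∈ 3F))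
  where
  ∈-level⁻ : ∀ i → _
  ∈-level⁻ i = ∈-filter⁻ (λ v → weight v ℕ.≟ t) {xs = vectors digits n} (terms∈ i)

  digits∈ : ∀ i → VecAll.All (_∈ digits) (term x d (toℕ i))
  digits∈ i = ∈-vectors⁻ digits _ (proj₁ (∈-level⁻ i))

  weight≡t : ∀ i → weight (term x d (toℕ i)) ≡ t
  weight≡t i = proj₂ (∈-level⁻ i)

  conclude : _ → _
  -- The terms with indices 1 and 0 coincide, against properness.
  conclude (inj₁ (y≡x , _)) = contradiction (proper {1F} {0F} y≡x) λ ()
  -- All four weights are `t`, so the strict inequality would read `t + t < t + t`.
  conclude (inj₂ w<)        = ℕ.<-irrefl
    (trans (cong₂ ℕ._+_ (weight≡t 1F) (weight≡t 2F))
      (sym (cong₂ ℕ._+_ (weight≡t 0F) (weight≡t 3F)))) w<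

-- The weight takes at most 2n + 1 values, namely 0 to 2n, and each level set has size at most
-- `r 4 11 n` by maximality.
7^n≤[1+2n]*r : ∀ n → 7 ^ n ≤ suc (n ℕ.* 2) ℕ.* r 4 11 n
7^n≤[1+2n]*r n = begin
  7 ^ n                          ≡⟨ length-vectors digits n ⟨
  length (vectors digits n)      ≤⟨ length≤*fibre weight (suc (n ℕ.* 2)) (vectors digits n)
                                      level≤r
                                      (ListAll.tabulate λ {x} _ → s≤s (weight≤n*2 x)) ⟩
  suc (n ℕ.* 2) ℕ.* r 4 11 n     ∎
  where
  open ℕ.≤-Reasoning
  level≤r : ∀ t → length (fibre weight t (vectors digits n)) ≤ r 4 11 n
  level≤r t = proj₂ (r-isMaximum 4 11 n) _
    ( fibre weight t (vectors digits n)
    , Unique-filter⁺ _ (vectors-unique digits (from-yes (unique? digits)) n)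
    , level-progressionFree n t
    , refl)

-- Source of the constant 1/3: since n ≥ 1, 2n + 1 ≤ 3n ≤ 3n³, with equality at n = 1.
1+2n≤3n³ : ∀ n .{{_ : NonZero n}} → suc (n ℕ.* 2) ≤ 3 ℕ.* n ^ 3
1+2n≤3n³ n@(suc _) = begin
  1 ℕ.+ n ℕ.* 2  ≤⟨ ℕ.+-monoˡ-≤ (n ℕ.* 2) (s≤s z≤n) ⟩
  n ℕ.+ n ℕ.* 2  ≡⟨ ℕ.*-suc n 2 ⟨
  n ℕ.* 3        ≡⟨ ℕ.*-comm n 3 ⟩
  -- `n ^ 3` unfolds to `n * n ^ 2`, and the second factor is nonzero.
  3 ℕ.* n        ≤⟨ ℕ.*-monoʳ-≤ 3 (ℕ.m≤m*n n (n ^ 2) {{m^n≢0 n 2}}) ⟩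
  3 ℕ.* n ^ 3    ∎
  where open ℕ.≤-Reasoning

-- Cross-multiplication, done in `ℚᵘ` because `_/_` on `ℚ` reduces to lowest terms and thereby hides
-- `b` and `d`.
⅓*[b/d]≤a : ∀ a b d .{{_ : NonZero d}} → b ≤ 3 ℕ.* d ℕ.* a →
  (+ a) / 1 ≥ (+ 1 / 3) * ((+ b) / d)
⅓*[b/d]≤a a b d@(suc d-1) b≤3da = ℚ.toℚᵘ-cancel-≤ (begin
  toℚᵘ ((+ 1 / 3) * ((+ b) / d))             ≃⟨ ℚ.toℚᵘ-homo-* (+ 1 / 3) ((+ b) / d) ⟩
  toℚᵘ (+ 1 / 3) ℚᵘ.* toℚᵘ ((+ b) / d)       ≃⟨ ℚᵘ.*-congˡ {toℚᵘ (+ 1 / 3)}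
                                                   (ℚ.toℚᵘ-fromℚᵘ (ℚᵘ.mkℚᵘ (+ b) d-1)) ⟩
  -- `mkℚᵘ` takes the denominator minus one: 2 encodes 3, `d-1` encodes `d`, and 0 encodes 1.
  ℚᵘ.mkℚᵘ (+ 1) 2 ℚᵘ.* ℚᵘ.mkℚᵘ (+ b) d-1     ≤⟨ ℚᵘ.*≤* (subst₂ ℤ._≤_ lhs rhs (+≤+ b≤3da)) ⟩
  ℚᵘ.mkℚᵘ (+ a) 0                            ≃⟨ ℚ.toℚᵘ-fromℚᵘ (ℚᵘ.mkℚᵘ (+ a) 0) ⟨
  toℚᵘ ((+ a) / 1)                           ∎)
  where
  open ℚᵘ.≤-Reasoning
  lhs : + b ≡ + 1 ℤ.* + b ℤ.* + 1
  lhs = sym (trans (ℤ.*-identityʳ (+ 1 ℤ.* + b)) (ℤ.*-identityˡ (+ b)))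
  rhs : + (3 ℕ.* d ℕ.* a) ≡ + a ℤ.* + (3 ℕ.* d)
  rhs = trans (cong +_ (ℕ.*-comm (3 ℕ.* d) a)) (ℤ.pos-* a (3 ℕ.* d))

theorem3p12 : ∃ λ (c : ℚ) → c > 0ℚ ×
    (∀ (n : ℕ) .{{_ : NonZero n}} →
    (+ r 4 11 n) / 1 ≥ c * _/_ (+ (7 ^ n)) (n ^ 3) {{m^n≢0 n 3}})
theorem3p12 = + 1 / 3 , from-yes (0ℚ ℚ.<? + 1 / 3) , λ n →
  ⅓*[b/d]≤a (r 4 11 n) (7 ^ n) (n ^ 3) {{m^n≢0 n 3}}
    (ℕ.≤-trans (7^n≤[1+2n]*r n) (ℕ.*-monoˡ-≤ (r 4 11 n) (1+2n≤3n³ n)))
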